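{- Let $\alpha$ be a type, let $A$ and $X$ be sets of constructions (i.e. $A,X\subseteq\mathcal{P}(\mathrm{Node}_\alpha)$), and let $M\in\mathcal{P}(\mathrm{Node}_\alpha)$. If $M\in X$ and $X\subseteq \mathrm{List\_Fun}\,A\,X\cup\mathrm{LList}\,A$, then $M\in\mathrm{LList}\,A$.
   Context: Setting: classical higher-order logic. $\mathbb{N}$ denotes the natural numbers including $0$; $\sigma+\tau$ is the disjoint sum type with injections $\mathrm{Inl},\mathrm{Inr}$. Nodes and trees: for a type $\alpha$, $\mathrm{Node}_\alpha$ is the type of pairs $(g,y)$ with $g:\mathbb{N}\to\mathbb{N}$, $y:\alpha+\mathbb{N}$, such that $g\,n=0$ for some $n$. A construction (tree) is an arbitrary set of nodes, i.e. an element of $\mathcal{P}(\mathrm{Node}_\alpha)$. For $k\in\mathbb{N}$ and $g:\mathbb{N}\to\mathbb{N}$, $\mathrm{Push}\,k\,g:\mathbb{N}\to\mathbb{N}$ is given by $(\mathrm{Push}\,k\,g)(0)=k+1$ and $(\mathrm{Push}\,k\,g)(j+1)=g(j)$. Define $M\cdot N=\{(\mathrm{Push}\,0\,g,y)\mid (g,y)\in M\}\cup\{(\mathrm{Push}\,1\,g,y)\mid (g,y)\in N\}$, $\mathrm{Numb}\,k=\{(\lambda i.0,\ \mathrm{Inr}\,k)\}$, $\mathrm{In0}\,M=\mathrm{Numb}\,0\cdot M$, $\mathrm{In1}\,N=\mathrm{Numb}\,1\cdot N$. Operators on sets of constructions: $A\otimes B=\{x\cdot y\mid x\in A,\ y\in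 B\}$ and $A\oplus B=\{\mathrm{In0}\,x\mid x\in A\}\cup\{\mathrm{In1}\,y\mid y\in B\}$. Greatest fixedpoint: for an operator $F$ on subsets of a type, $\mathrm{gfp}\,F=\bigcup\{X\mid X\subseteq F\,X\}$. Lazy lists: $\mathrm{List\_Fun}\,A\,Z=\{\mathrm{Numb}\,0\}\oplus(A\otimes Z)$ and $\mathrm{LList}\,A=\mathrm{gfp}(\lambda Z.\ \mathrm{List\_Fun}\,A\,Z)$. -}

module Defs where

open import Level using (Level; _⊔_; suc)
open import Data.Nat using (ℕ; zero)
import Data.Nat as Nat
open import Data.Product using (Σ; _×_; _,_; ∃)
open import Data.Sum using (_⊎_; inj₂)
import Data.Sum as Sum
open import Function using (id)
open import Relation.Binary using (Setoid; _Respects_)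
open import Relation.Binary.PropositionalEquality using (_≡_; _≗_; refl; sym; trans)
import Relation.Unary as U

private
  variable
    a c c₁ c₂ c₃ e e₁ e₂ e₃ ℓ ℓ₁ ℓ₂ : Level

-- Agda has neither function nor predicate extensionality, so the equality of
-- higher-order logic is carried by setoids: a subset is a predicate that
-- respects the equality of the ambient setoid, and two subsets are equal when
-- they have the same elements.

record ℙ (S : Setoid c e) (ℓ : Level) : Set (c ⊔ e ⊔ suc ℓ) where
  open Setoid S
  field
    member : U.Pred Carrier ℓ
    resp   : member Respects _≈_

open ℙ public

infix  4 _∈_ _⊆_
infixr 6 _∪_

_∈_ : {S : Setoid c e} → Setoid.Carrier S → ℙ S ℓ → Set ℓ
x ∈ A = member A x

_⊆_ : {S : Setoid c e} → ℙ S ℓ₁ → ℙ S ℓ₂ → Set (c ⊔ ℓ₁ ⊔ ℓ₂)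
A ⊆ B = member A U.⊆ member B

powerset : Setoid c e → (ℓ : Level) → Setoid (c ⊔ e ⊔ suc ℓ) (c ⊔ ℓ)
powerset S ℓ = record
  { Carrier       = ℙ S ℓ
  ; _≈_           = λ A B → member A U.≐ member B
  ; isEquivalence = record
    { refl  = id , id
    ; sym   = λ (A⊆B , B⊆A) → B⊆A , A⊆B
    ; trans = λ (A⊆B , B⊆A) (B⊆C , C⊆B) → (λ x → B⊆C (A⊆B x)) , (λ x → B⊆A (C⊆B x))
    }
  }

_∪_ : {S : Setoid c e} → ℙ S ℓ₁ → ℙ S ℓ₂ → ℙ S (ℓ₁ ⊔ ℓ₂)
A ∪ B = record
  { member = member A U.∪ member B
  ; resp   = λ x≈y → Sum.map (resp A x≈y) (resp B x≈y)
  }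

singleton : (S : Setoid c e) → Setoid.Carrier S → ℙ S e
singleton S x = record
  { member = λ z → z ≈ x
  ; resp   = λ z≈w z≈x → S.trans (S.sym z≈w) z≈x
  }
  where
    module S = Setoid S
    open S using (_≈_)

-- { f x ∣ x ∈ A }
image : {S : Setoid c₁ e₁} (T : Setoid c₂ e₂) →
        (Setoid.Carrier S → Setoid.Carrier T) → ℙ S ℓ → ℙ T (c₁ ⊔ e₂ ⊔ ℓ)
image T f A = record
  { member = λ z → ∃ λ x → x ∈ A × z ≈ f x
  ; resp   = λ z≈w (x , x∈A , z≈fx) → x , x∈A , T.trans (T.sym z≈w) z≈fx
  }
  where
    module T = Setoid T
    open T using (_≈_)

-- { f x y ∣ x ∈ A , y ∈ B }
image₂ : {S : Setoid c₁ e₁} {T : Setoid c₂ e₂} (V : Setoid c₃ e₃) →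
         (Setoid.Carrier S → Setoid.Carrier T → Setoid.Carrier V) →
         ℙ S ℓ₁ → ℙ T ℓ₂ → ℙ V (c₁ ⊔ c₂ ⊔ e₃ ⊔ ℓ₁ ⊔ ℓ₂)
image₂ V f A B = record
  { member = λ z → ∃ λ x → ∃ λ y → x ∈ A × y ∈ B × z ≈ f x y
  ; resp   = λ z≈w (x , y , x∈A , y∈B , z≈fxy) →
               x , y , x∈A , y∈B , V.trans (V.sym z≈w) z≈fxy
  }
  where
    module V = Setoid V
    open V using (_≈_)

-- ⋃ { X ∣ X ⊆ F X }.  The union ranges over all subsets at level ℓ, so by
-- predicativity it lives in a larger universe than its members.
gfp : {S : Setoid c e} → (ℙ S ℓ → ℙ S ℓ) → ℙ S (c ⊔ e ⊔ suc ℓ)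
gfp {ℓ = ℓ} {S = S} F = record
  { member = λ x → Σ (ℙ S ℓ) λ X → X ⊆ F X × x ∈ X
  ; resp   = λ x≈y (X , X⊆FX , x∈X) → X , X⊆FX , resp X x≈y x∈X
  }

record Node (α : Set a) : Set a where
  constructor node
  field
    path  : ℕ → ℕ
    label : α ⊎ ℕ
    ends  : ∃ λ n → path n ≡ 0

open Node public

-- A node is the pair (path , label): `ends` is a side condition on the pair
-- and plays no part in equality.
nodeSetoid : Set a → Setoid a a
nodeSetoid α = record
  { Carrier       = Node α
  ; _≈_           = λ m n → path m ≗ path n × label m ≡ label n
  ; isEquivalence = record
    { refl  = (λ _ → refl) , refl
    ; sym   = λ (p , q) → (λ i → sym (p i)) , sym q
    ; trans = λ (p , q) (p′ , q′) → (λ i → trans (p i) (p′ i)) , trans q q′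
    }
  }

treeSetoid : Set a → Setoid (suc a) a
treeSetoid {a} α = powerset (nodeSetoid α) a

Tree : Set a → Set (suc a)
Tree α = Setoid.Carrier (treeSetoid α)

-- The level `suc a` is the least one closed under `_⊗_` and `_⊕_`.
TreeSet : Set a → Set (suc (suc a))
TreeSet {a} α = ℙ (treeSetoid α) (suc a)

Push : ℕ → (ℕ → ℕ) → (ℕ → ℕ)
Push k g zero        = Nat.suc k
Push k g (Nat.suc j) = g j

pushNode : {α : Set a} → ℕ → Node α → Node α
pushNode k (node g y (n , gn≡0)) = node (Push k g) y (Nat.suc n , gn≡0)

infixr 7 _·_ _⊗_
infixr 6 _⊕_

_·_ : {α : Set a} → Tree α → Tree α → Tree α
_·_ {α = α} M N =
  image (nodeSetoid α) (pushNode 0) M ∪ image (nodeSetoid α) (pushNode 1) N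

Numb : {α : Set a} → ℕ → Tree α
Numb {α = α} k = singleton (nodeSetoid α) (node (λ _ → 0) (inj₂ k) (0 , refl))

In0 : {α : Set a} → Tree α → Tree α
In0 M = Numb 0 · M

In1 : {α : Set a} → Tree α → Tree α
In1 N = Numb 1 · N

_⊗_ : {α : Set a} → ℙ (treeSetoid α) ℓ₁ → ℙ (treeSetoid α) ℓ₂ →
      ℙ (treeSetoid α) (suc a ⊔ ℓ₁ ⊔ ℓ₂)
_⊗_ {α = α} A B = image₂ (treeSetoid α) _·_ A B

_⊕_ : {α : Set a} → ℙ (treeSetoid α) ℓ₁ → ℙ (treeSetoid α) ℓ₂ →
      ℙ (treeSetoid α) (suc a ⊔ ℓ₁ ⊔ ℓ₂)
_⊕_ {α = α} A B = image (treeSetoid α) In0 A ∪ image (treeSetoid α) In1 B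

List-Fun : {α : Set a} → TreeSet α → TreeSet α → TreeSet α
List-Fun {α = α} A Z = singleton (treeSetoid α) (Numb 0) ⊕ (A ⊗ Z)

LList : {α : Set a} → TreeSet α → ℙ (treeSetoid α) (suc (suc a))
LList A = gfp (λ Z → List-Fun A Z)

{-# OPTIONS --safe #-}

-- Classically one checks that X ∪ gfp F is contained in its own image under F.
-- Here gfp F lies in a higher universe than the sets it is the union of, so it
-- cannot itself serve as such a set.  But the hypothesis on X provides, for
-- each x ∈ X, either x ∈ F X or one particular set Z ⊆ F Z containing x; these
-- sets Z form a family indexed by the elements of X, and the union of X with
-- this family is small.
module Submission where

open import Level using (Level; _⊔_)
open import Data.Empty.Polymorphic using (⊥)
open import Data.Product using (∃; _,_; proj₁)
import Data.Product as Product
open import Data.Sum using (inj₁; inj₂; [_,_])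
import Data.Sum as Sum
open import Function using (id; const; _∘_)
open import Relation.Binary using (Setoid)
open import Defs

private
  variable
    a c e i ℓ : Level

∅ : {S : Setoid c e} → ℙ S ℓ
∅ = record { member = λ _ → ⊥ ; resp = λ _ () }

⋃ : {S : Setoid c e} {I : Set i} → (I → ℙ S ℓ) → ℙ S (i ⊔ ℓ)
⋃ P = record
  { member = λ x → ∃ λ i → x ∈ P i
  ; resp   = λ x≈y → Product.map₂ λ {i} → resp (P i) x≈y
  }

Monotone : {S : Setoid c e} → (ℙ S ℓ → ℙ S ℓ) → Set _
Monotone F = ∀ {X Y} → X ⊆ Y → F X ⊆ F Y

module _ {c e ℓ} {S : Setoid c e} (F : ℙ S (c ⊔ ℓ) → ℙ S (c ⊔ ℓ)) (mono : Monotone F)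
  where

  module _ (X : ℙ S (c ⊔ ℓ)) where

    witness : ∀ {x} → x ∈ F X ∪ gfp F → ℙ S (c ⊔ ℓ)
    -- `∅` is the default on the left summand: being vacuously postfixed, it extends the family to
    -- all of `X`.
    witness = [ const ∅ , proj₁ ]

    witness-postfixed : ∀ {x} (u : x ∈ F X ∪ gfp F) → witness u ⊆ F (witness u)
    witness-postfixed (inj₁ _)              ()
    witness-postfixed (inj₂ (_ , Z⊆FZ , _)) = Z⊆FZ

    ∈F[X∪witness] : ∀ {x} (u : x ∈ F X ∪ gfp F) → x ∈ F (X ∪ witness u)
    ∈F[X∪witness] (inj₁ x∈FX)             = mono {X} {X ∪ ∅} inj₁ x∈FX
    ∈F[X∪witness] (inj₂ (Z , Z⊆FZ , x∈Z)) = mono {Z} {X ∪ Z} inj₂ (Z⊆FZ x∈Z)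

  gfp-coinduction : ∀ {X} → X ⊆ F X ∪ gfp F → X ⊆ gfp F
  gfp-coinduction {X} h x∈X = W , [ X⊆FW , Zs⊆FW ] , inj₁ x∈X
    where
    Z : ∃ (member X) → ℙ S (c ⊔ ℓ)
    Z (_ , x∈X) = witness X (h x∈X)

    -- An index of `Z` is a carrier element with a membership proof, so the index type has level
    -- `c ⊔ ℓ` and `W` stays at the level on which `F` acts.
    W : ℙ S (c ⊔ ℓ)
    W = X ∪ ⋃ Z

    X⊆FW : X ⊆ F W
    X⊆FW x∈X = mono {X ∪ Z (_ , x∈X)} {W} (Sum.map id (_ ,_)) (∈F[X∪witness] X (h x∈X))

    Zs⊆FW : ⋃ Z ⊆ F W
    Zs⊆FW (p@(_ , x∈X) , z∈Zp) =
      mono {Z p} {W} (inj₂ ∘ (p ,_)) (witness-postfixed X (h x∈X) z∈Zp)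

List-Fun-mono : {α : Set a} (A : TreeSet α) → Monotone (List-Fun A)
List-Fun-mono A X⊆Y =
  Sum.map₂ λ (N , (x , y , x∈A , y∈X , N≈xy) , M≈In1N) →
    N , (x , y , x∈A , X⊆Y y∈X , N≈xy) , M≈In1N

mainTheorem2 : {a : Level} (α : Set a) (A X : TreeSet α) (M : Tree α) →
    M ∈ X → X ⊆ List-Fun A X ∪ LList A → M ∈ LList A
mainTheorem2 {a} α A X M M∈X X⊆ =
  -- Here `c` is `suc a`, the level of `Tree α`, so `c ⊔ a` is `suc a`, the level of `TreeSet`.
  gfp-coinduction {ℓ = a} (List-Fun A) (λ {Y} {Z} → List-Fun-mono A {Y} {Z}) {X} X⊆ M∈X
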